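{- Let $(X,d)$ be a nonempty, separable, ultrametric metric space which is spherically dense. Then: (a) for every $c_0\in X$, all real numbers $0\le r_1<r_0$, and every $z\in X$, there exists $c_1\in X$ such that $B(c_1,r_1)\subseteq B(c_0,r_0)$ and $z\notin B(c_1,r_1)$; (b) $X$ is not spherically complete.
   Context: $B(c,r)=\{x: d(x,c)\le r\}$ is the closed ball, $r\ge0$. A metric space is spherically dense if $\operatorname{diam}(B(c,r))=r$ for every $c\in X$ and every $r\ge 0$, where $\operatorname{diam}(A)=\sup_{x,y\in A}d(x,y)$. Ultrametric: $d(x,z)\le\max(d(x,y),d(y,z))$. Separable: has a countable dense subset. Spherically complete: for all sequences $(c_i)$ in $X$, $(r_i)$ in $\mathbb R_{\ge0}$ with $B(c_0,r_0)\supseteq B(c_1,r_1)\supseteq\cdots$, $\bigcap_i B(c_i,r_i)\ne\emptyset$. -}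

module Defs where

open import Data.Nat.Base using (ℕ; suc)
open import Data.Product.Base using (∃; ∃₂; _×_; _,_; proj₁; proj₂; swap)
open import Data.Rational.Base as ℚ using (ℚ; 0ℚ)
import Data.Rational.Properties as ℚ
open import Data.Sum.Base as Sum using (_⊎_; inj₁; inj₂; [_,_]′)
open import Function.Base using (id; _∘_)
open import Function.Bundles using (Injection)
open import Function.Metric.Core using (DistanceFunction)
open import Function.Metric.Structures using (IsGeneralMetric)
open import Level using (Level; 0ℓ) renaming (suc to lsuc; _⊔_ to _⊔ℓ_)
open import Relation.Binary.Bundles using (Setoid)
open import Relation.Binary.Core using (Rel)
import Relation.Binary.Construct.On as On
open import Relation.Binary.Definitions using (tri<; tri≈; tri>)
open import Relation.Binary.PropositionalEquality using (refl)
import Relation.Binary.PropositionalEquality.Properties as ≡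
open import Relation.Binary.Structures using (IsPartialOrder)
open import Relation.Nullary.Negation.Core using (¬_)
open import Relation.Unary using (Pred; _∈_; _⊆_; _∪_; _∩_; ⋂; Satisfiable)

private
  variable
    a ℓ p : Level

-- Real numbers as two-sided Dedekind cuts of ℚ.

record ℝ : Set₁ where
  field
    L U         : Pred ℚ 0ℓ
    L-inhabited : ∃ λ q → q ∈ L
    U-inhabited : ∃ λ q → q ∈ U
    L-lower     : ∀ {q r} → q ℚ.< r → r ∈ L → q ∈ L
    U-upper     : ∀ {q r} → q ℚ.< r → q ∈ U → r ∈ U
    L-open      : ∀ {q} → q ∈ L → ∃ λ r → q ℚ.< r × r ∈ L
    U-open      : ∀ {r} → r ∈ U → ∃ λ q → q ℚ.< r × q ∈ U
    disjoint    : ∀ {q} → ¬ (q ∈ L × q ∈ U)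
    located     : ∀ {q r} → q ℚ.< r → q ∈ L ⊎ r ∈ U

open ℝ

infix 4 _≤_ _<_ _≈_
infixl 6 _⊔_

-- Inclusion of lower cuts; a record so that x and y can be inferred from
-- a proof of x ≤ y.
record _≤_ (x y : ℝ) : Set where
  constructor *≤*
  field
    L⊆L : L x ⊆ L y

open _≤_ public

_≈_ : Rel ℝ 0ℓ
x ≈ y = x ≤ y × y ≤ x

_<_ : Rel ℝ 0ℓ
x < y = ∃ λ q → q ∈ U x × q ∈ L y

≤-isPartialOrder : IsPartialOrder _≈_ _≤_
≤-isPartialOrder = record
  { isPreorder = record
    { isEquivalence = record
      { refl  = *≤* id , *≤* id
      ; sym   = swap
      ; trans = λ (a , b) (c , d) → ≤-trans a c , ≤-trans d b
      }
    ; reflexive = proj₁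
    ; trans     = ≤-trans
    }
  ; antisym = _,_
  }
  where
  ≤-trans : ∀ {x y z} → x ≤ y → y ≤ z → x ≤ z
  ≤-trans (*≤* f) (*≤* g) = *≤* (g ∘ f)

fromℚ : ℚ → ℝ
fromℚ s = record
  { L           = ℚ._< s
  ; U           = s ℚ.<_
  ; L-inhabited = s ℚ.- ℚ.1ℚ , below
  ; U-inhabited = s ℚ.+ ℚ.1ℚ , above
  ; L-lower     = ℚ.<-trans
  ; U-upper     = λ q<r s<q → ℚ.<-trans s<q q<r
  ; L-open      = ℚ.<-dense
  ; U-open      = λ s<r → let (m , s<m , m<r) = ℚ.<-dense s<r in m , m<r , s<m
  ; disjoint    = λ (q<s , s<q) → ℚ.<-asym q<s s<q
  ; located     = loc
  }
  where
  below : s ℚ.- ℚ.1ℚ ℚ.< s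
  below = ℚ.<-respʳ-≡ (ℚ.+-identityʳ s) (ℚ.+-monoʳ-< s (ℚ.negative⁻¹ (ℚ.- ℚ.1ℚ)))
  above : s ℚ.< s ℚ.+ ℚ.1ℚ
  above = ℚ.<-respˡ-≡ (ℚ.+-identityʳ s) (ℚ.+-monoʳ-< s (ℚ.positive⁻¹ ℚ.1ℚ))
  loc : ∀ {q r} → q ℚ.< r → q ℚ.< s ⊎ s ℚ.< r
  loc {q} q<r with ℚ.<-cmp q s
  ... | tri< q<s _ _    = inj₁ q<s
  ... | tri≈ _ refl _   = inj₂ q<r
  ... | tri> _ _ s<q    = inj₂ (ℚ.<-trans s<q q<r)

0ℝ : ℝ
0ℝ = fromℚ 0ℚ

_⊔_ : ℝ → ℝ → ℝ
x ⊔ y = record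
  { L           = L x ∪ L y
  ; U           = U x ∩ U y
  ; L-inhabited = let (q , q∈) = L-inhabited x in q , inj₁ q∈
  ; U-inhabited = inh
  ; L-lower     = λ q<r → Sum.map (L-lower x q<r) (L-lower y q<r)
  ; U-upper     = λ q<r (u , v) → U-upper x q<r u , U-upper y q<r v
  ; L-open      = [ (λ l → let (r , q<r , r∈) = L-open x l in r , q<r , inj₁ r∈)
                  , (λ l → let (r , q<r , r∈) = L-open y l in r , q<r , inj₂ r∈) ]′
  ; U-open      = opn
  ; disjoint    = λ { (inj₁ l , u , _) → disjoint x (l , u)
                    ; (inj₂ l , _ , u) → disjoint y (l , u) }
  ; located     = loc
  }
  where
  inh : ∃ λ q → q ∈ U x ∩ U y
  inh with U-inhabited x | U-inhabited y
  ... | q , q∈ | r , r∈ with ℚ.<-cmp q r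
  ...   | tri< q<r _ _  = r , U-upper x q<r q∈ , r∈
  ...   | tri≈ _ refl _ = r , q∈ , r∈
  ...   | tri> _ _ r<q  = q , q∈ , U-upper y r<q r∈
  opn : ∀ {r} → r ∈ U x ∩ U y → ∃ λ q → q ℚ.< r × q ∈ U x ∩ U y
  opn (u , v) with U-open x u | U-open y v
  ... | q , q<r , q∈ | s , s<r , s∈ with ℚ.<-cmp q s
  ...   | tri< q<s _ _  = s , s<r , U-upper x q<s q∈ , s∈
  ...   | tri≈ _ refl _ = s , s<r , q∈ , s∈
  ...   | tri> _ _ s<q  = q , q<r , q∈ , U-upper y s<q s∈
  loc : ∀ {q r} → q ℚ.< r → q ∈ L x ∪ L y ⊎ r ∈ U x ∩ U y
  loc q<r with located x q<r | located y q<r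
  ... | inj₁ l | _      = inj₁ (inj₁ l)
  ... | inj₂ _ | inj₁ l = inj₁ (inj₂ l)
  ... | inj₂ u | inj₂ v = inj₂ (u , v)

IsSupremum : Pred ℝ p → ℝ → Set (lsuc 0ℓ ⊔ℓ p)
IsSupremum A s =
  (∀ t → t ∈ A → t ≤ s) × (∀ u → (∀ t → t ∈ A → t ≤ u) → s ≤ u)

-- A real-valued analogue of Function.Metric.Rational.Bundles.UltraMetric.
-- The ordinary triangle inequality is implied, distances being nonnegative.
record UltraMetricSpace a ℓ : Set (lsuc (a ⊔ℓ ℓ ⊔ℓ lsuc 0ℓ)) where
  infix 4 _≈ₓ_
  field
    Carrier       : Set a
    _≈ₓ_          : Rel Carrier ℓ
    d             : DistanceFunction Carrier ℝ
    isUltraMetric : IsGeneralMetric _≈ₓ_ _≈_ _≤_ 0ℝ _⊔_ d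

  open IsGeneralMetric isUltraMetric public using (≈-isEquivalence)

  setoid : Setoid a ℓ
  setoid = record { isEquivalence = ≈-isEquivalence }

module _ (X : UltraMetricSpace a ℓ) where
  open UltraMetricSpace X

  Ball : Carrier → ℝ → Pred Carrier 0ℓ
  Ball c r x = d x c ≤ r

  -- diam A = s, as a relation since A need not be bounded.
  HasDiameter : Pred Carrier p → ℝ → Set (lsuc 0ℓ ⊔ℓ a ⊔ℓ p)
  HasDiameter A =
    IsSupremum (λ t → ∃₂ λ x y → x ∈ A × y ∈ A × t ≈ d x y)

  SphericallyDense : Set (lsuc 0ℓ ⊔ℓ a)
  SphericallyDense = ∀ c r → 0ℝ ≤ r → HasDiameter (Ball c r) r

  -- Finite or countably infinite: the elements of S, up to _≈ₓ_, inject
  -- into ℕ.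
  Countable : Pred Carrier p → Set (a ⊔ℓ ℓ ⊔ℓ p)
  Countable S = Injection (On.setoid setoid (proj₁ {B = S})) (≡.setoid ℕ)

  Dense : Pred Carrier p → Set (lsuc 0ℓ ⊔ℓ a ⊔ℓ p)
  Dense S = ∀ x ε → 0ℝ < ε → ∃ λ y → y ∈ S × d x y < ε

  Separable : ∀ p → Set (lsuc 0ℓ ⊔ℓ a ⊔ℓ ℓ ⊔ℓ lsuc p)
  Separable p = ∃ λ (S : Pred Carrier p) → Countable S × Dense S

  SphericallyComplete : Set (lsuc 0ℓ ⊔ℓ a)
  SphericallyComplete =
    ∀ (c : ℕ → Carrier) (r : ℕ → ℝ) → (∀ i → 0ℝ ≤ r i) →
    (∀ i → Ball (c (suc i)) (r (suc i)) ⊆ Ball (c i) (r i)) →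
    Satisfiable (⋂ ℕ (λ i → Ball (c i) (r i)))

{-# OPTIONS --safe #-}

-- Since r₁ < r₀ = diam B(c₀, r₀), the ball B(c₀, r₀) contains two points more
-- than r₁ apart; by the ultrametric inequality z is not within r₁ of both, so
-- one of them can serve as c₁. Diagonalising against an enumeration e of a
-- dense set, with radii strictly decreasing but above 1, gives nested balls
-- whose (n+1)-st omits e n. A point of the intersection would have some e n
-- within distance 1, and that e n would then lie in every one of the balls.
module Submission where

open import Defs
open import Axiom.ExcludedMiddle using (ExcludedMiddle)
open import Data.Empty using (⊥; ⊥-elim)
open import Data.Nat.Base using (ℕ; zero; suc)
open import Data.Product.Base using (∃; ∃₂; _×_; _,_; proj₁; proj₂)
open import Data.Rational.Base as ℚ using (1ℚ)
import Data.Rational.Properties as ℚ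
open import Data.Sum.Base using (inj₁; inj₂; [_,_]′)
open import Function.Bundles using (module Injection)
open import Function.Metric.Structures using (module IsGeneralMetric)
open import Level using (Level)
open import Relation.Binary.Bundles using (module Setoid)
open import Relation.Binary.Definitions using (tri<; tri≈; tri>)
open import Relation.Binary.PropositionalEquality using (_≡_; refl)
open import Relation.Binary.Structures using (module IsPartialOrder)
open import Relation.Nullary.Decidable.Core using (yes; no; decidable-stable)
open import Relation.Nullary.Negation.Core using (¬_)
open import Relation.Unary using (Pred; _∈_; _⊆_; _∉_)

private
  variable
    a ℓ p : Level

open IsPartialOrder ≤-isPartialOrder using () renaming (trans to ≤-trans)

<⇒≤ : ∀ {x y} → x < y → x ≤ y
<⇒≤ {x} {y} (q , q∈U , q∈L) = *≤* below
  where
  below : ℝ.L x ⊆ ℝ.L y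
  below {s} s∈L with ℚ.<-cmp s q
  ... | tri< s<q _ _  = ℝ.L-lower y s<q q∈L
  ... | tri≈ _ refl _ = q∈L
  ... | tri> _ _ q<s  = ⊥-elim (ℝ.disjoint x (ℝ.L-lower x q<s s∈L , q∈U))

<⇒≱ : ∀ {x y} → x < y → ¬ y ≤ x
<⇒≱ {x} (q , q∈U , q∈L) y≤x = ℝ.disjoint x (L⊆L y≤x q∈L , q∈U)

⊔-lub : ∀ {x y z} → x ≤ z → y ≤ z → x ⊔ y ≤ z
⊔-lub (*≤* f) (*≤* g) = *≤* [ f , g ]′

-- A rational strictly between `q` and `s` is exactly the witness that `_<_` on cuts asks for.
fromℚ-mono-< : ∀ {q s} → q ℚ.< s → fromℚ q < fromℚ s
fromℚ-mono-< = ℚ.<-dense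

module _ (X : UltraMetricSpace a ℓ) where
  open UltraMetricSpace X
  open IsGeneralMetric isUltraMetric using () renaming
    (cong to d-cong; sym to d-sym; triangle to d-triangle)

  Ball-sym : ∀ {x c r} → x ∈ Ball X c r → c ∈ Ball X x r
  Ball-sym {x} {c} = ≤-trans (proj₁ (d-sym c x))

  Ball-trans : ∀ {x y c r} → x ∈ Ball X y r → y ∈ Ball X c r → x ∈ Ball X c r
  Ball-trans {x} {y} {c} x∈ y∈ = ≤-trans (d-triangle x y c) (⊔-lub x∈ y∈)

  Ball-resp-≈ₓ : ∀ {x y c r} → x ≈ₓ y → x ∈ Ball X c r → y ∈ Ball X c r
  Ball-resp-≈ₓ x≈y = ≤-trans (proj₂ (d-cong x≈y (Setoid.refl setoid)))

  module _ (em : ∀ {ℓ} → ExcludedMiddle ℓ) where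

    -- By contradiction: otherwise `r` bounds every distance within `A`, and leastness of the
    -- supremum gives `s ≤ r`. Excluded middle is what extracts an actual pair from this.
    distant-pair : ∀ {A : Pred Carrier p} {r s} → HasDiameter X A s → r < s →
                   ∃₂ λ x y → x ∈ A × y ∈ A × ¬ d x y ≤ r
    distant-pair {r = r} (_ , least) r<s = decidable-stable em λ none →
      <⇒≱ r<s (least r λ t (x , y , x∈A , y∈A , t≈d) →
        ≤-trans (proj₁ t≈d)
          (decidable-stable em λ d≰r → none (x , y , x∈A , y∈A , d≰r)))

    avoiding-ball : SphericallyDense X →
                    ∀ c₀ r₁ r₀ → 0ℝ ≤ r₁ → r₁ < r₀ → ∀ z →
                    ∃ λ c₁ → Ball X c₁ r₁ ⊆ Ball X c₀ r₀ × z ∉ Ball X c₁ r₁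
    avoiding-ball dense c₀ r₁ r₀ 0≤r₁ r₁<r₀ z
      with distant-pair (dense c₀ r₀ (≤-trans 0≤r₁ (<⇒≤ r₁<r₀))) r₁<r₀
    ... | x , y , x∈B , y∈B , d≰r₁ with em {P = z ∈ Ball X x r₁}
    ...   | no z∉  = x , (λ w∈ → Ball-trans (≤-trans w∈ (<⇒≤ r₁<r₀)) x∈B) , z∉
    -- If `z` were within `r₁` of `y` as well, then `x` and `y` would be within `r₁` of each other
    -- through `z`.
    ...   | yes z∈ = y , (λ w∈ → Ball-trans (≤-trans w∈ (<⇒≤ r₁<r₀)) y∈B)
                       , λ z∈′ → d≰r₁ (Ball-trans (Ball-sym z∈) z∈′)

    -- The injection into ℕ is inverted by deciding which numbers it hits. Numbers off its image get
    -- the default `x₀`, which may lie outside `S`; only covering `S` up to `≈ₓ` matters.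
    enumerate : Carrier → {S : Pred Carrier p} → Countable X S →
                ∃ λ (e : ℕ → Carrier) → ∀ x → x ∈ S → ∃ λ n → e n ≈ₓ x
    enumerate x₀ {S} count = e , λ x x∈S → to (x , x∈S) , e-to x x∈S
      where
      open Injection count using (to; injective)

      e : ℕ → Carrier
      e n with em {P = ∃ λ s → to s ≡ n}
      ... | yes ((x , _) , _) = x
      ... | no _              = x₀

      e-to : ∀ x (x∈S : x ∈ S) → e (to (x , x∈S)) ≈ₓ x
      e-to x x∈S with em {P = ∃ λ s → to s ≡ to (x , x∈S)}
      -- The preimage picked need not be `x` itself; injectivity identifies the two up to `≈ₓ`.
      ... | yes (_ , eq) = injective eq
      ... | no none      = ⊥-elim (none (_ , refl))

    ¬sphericallyComplete : Carrier → Separable X p → SphericallyDense X →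
                           ¬ SphericallyComplete X
    ¬sphericallyComplete x₀ (S , count , S-dense) dense complete
      with enumerate x₀ count
    ... | e , e-onto = contra
      where
      -- Start at 2 and keep choosing a rational between 1 and the last radius; the bound is carried
      -- along because the next choice needs it.
      radius : ℕ → ∃ λ q → 1ℚ ℚ.< q
      radius zero    = 1ℚ ℚ.+ 1ℚ , ℚ.+-monoʳ-< 1ℚ (ℚ.positive⁻¹ 1ℚ)
      radius (suc n) = let (m , 1<m , _) = ℚ.<-dense (proj₂ (radius n)) in m , 1<m

      r : ℕ → ℝ
      r n = fromℚ (proj₁ (radius n))

      r-decreasing : ∀ n → r (suc n) < r n
      r-decreasing n = fromℚ-mono-< (proj₂ (proj₂ (ℚ.<-dense (proj₂ (radius n)))))

      0<1 : 0ℝ < fromℚ 1ℚ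
      0<1 = fromℚ-mono-< (ℚ.positive⁻¹ 1ℚ)

      1≤r : ∀ n → fromℚ 1ℚ ≤ r n
      1≤r n = <⇒≤ (fromℚ-mono-< (proj₂ (radius n)))

      0≤r : ∀ n → 0ℝ ≤ r n
      0≤r n = ≤-trans (<⇒≤ 0<1) (1≤r n)

      next : ∀ n c → ∃ λ c′ → Ball X c′ (r (suc n)) ⊆ Ball X c (r n)
                            × e n ∉ Ball X c′ (r (suc n))
      next n c = avoiding-ball dense c _ _ (0≤r (suc n)) (r-decreasing n) (e n)

      c : ℕ → Carrier
      c zero    = x₀
      c (suc n) = proj₁ (next n (c n))

      contra : ⊥
      contra with complete c r 0≤r (λ n → proj₁ (proj₂ (next n (c n))))
      ... | x , x∈⋂ with S-dense x (fromℚ 1ℚ) 0<1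
      ...   | y , y∈S , d<1 with e-onto y y∈S
      -- Since 1 is below every radius, `y` is close enough to `x` to lie in ball `suc n`, the one
      -- chosen to omit `e n`.
      ...     | n , e≈y = proj₂ (proj₂ (next n (c n)))
        (Ball-resp-≈ₓ (Setoid.sym setoid e≈y)
          (Ball-trans (Ball-sym (≤-trans (<⇒≤ d<1) (1≤r (suc n)))) (x∈⋂ (suc n))))

theorem3p2 : (∀ {ℓ} → ExcludedMiddle ℓ) → ∀ {a ℓ p} (X : UltraMetricSpace a ℓ) → let open UltraMetricSpace X using (Carrier) in
    Carrier → Separable X p → SphericallyDense X →
    (∀ (c₀ : Carrier) (r₁ r₀ : ℝ) → 0ℝ ≤ r₁ → r₁ < r₀ → (z : Carrier) →
    ∃ λ c₁ → Ball X c₁ r₁ ⊆ Ball X c₀ r₀ × z ∉ Ball X c₁ r₁)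
    × (¬ SphericallyComplete X)
theorem3p2 em X x₀ separable dense =
  avoiding-ball X em dense , ¬sphericallyComplete X em x₀ separable dense
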